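{- For every integer $n \ge 3$: if $R_3(C_{2n}) = 4n$, then $R_3(P_{2n+1}) = 4n+1$.
   Context: All graphs are undirected, finite, with no loops or multiple edges. $P_k$ (resp. $C_k$) denotes the path (resp. cycle) on $k$ vertices, and $K_N$ denotes the complete graph on $N$ vertices. For a graph $G$, the three-color diagonal Ramsey number $R_3(G) = R(G,G,G)$ is the smallest integer $N$ such that every coloring of the edges of $K_N$ with 3 colors contains a monochromatic copy of $G$ (as a not necessarily induced subgraph), i.e. there is a color $i \in \{1,2,3\}$ such that the graph formed by the edges of color $i$ contains a subgraph isomorphic to $G$. -}

module Defs where

open import Data.Fin.Base using (Fin; toℕ)
open import Data.Fin.Subset using (Subset; _∈_)
open import Data.Nat.Base using (ℕ; suc; _≤_)
open import Data.Nat.Properties using (1+n≢n)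
open import Data.Product.Base using (∃; _×_; _,_; proj₁)
open import Data.Sum.Base as Sum using (_⊎_)
open import Function.Base using (_∘_)
open import Function.Bundles using (_↔_; _⇔_; Inverse)
open import Level using (0ℓ)
open import Relation.Binary.Core using (Rel)
open import Relation.Binary.Definitions using (Symmetric)
open import Relation.Binary.PropositionalEquality
  using (_≡_; _≢_; refl; sym; trans; ≢-sym)
open import Relation.Nullary.Negation.Core using (¬_)

record Graph (n : ℕ) : Set₁ where
  field
    Adj        : Rel (Fin n) 0ℓ
    adj-sym    : Symmetric Adj
    adj-irrefl : ∀ {u} → ¬ Adj u u

open Graph

complete : ∀ n → Graph n
complete n = record
  { Adj        = _≢_
  ; adj-sym    = ≢-sym
  ; adj-irrefl = λ u≢u → u≢u refl
  }

path : ∀ k → Graph k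
path k = record
  { Adj        = λ u v → toℕ v ≡ suc (toℕ u) ⊎ toℕ u ≡ suc (toℕ v)
  ; adj-sym    = Sum.swap
  ; adj-irrefl = Sum.[ 1+n≢n ∘ sym , 1+n≢n ∘ sym ]
  }

-- v follows u in the cyclic order 0, 1, …, k - 1, 0.
Next : ∀ {k} → Rel (Fin k) 0ℓ
Next {k} u v = toℕ v ≡ suc (toℕ u) ⊎ (suc (toℕ u) ≡ k × toℕ v ≡ 0)

-- The cycle on k vertices when k ≥ 3.  The condition u ≢ v only matters for
-- k = 1, where the single vertex is its own successor.
cycle : ∀ k → Graph k
cycle k = record
  { Adj        = λ u v → u ≢ v × (Next u v ⊎ Next v u)
  ; adj-sym    = λ (u≢v , e) → ≢-sym u≢v , Sum.swap e
  ; adj-irrefl = λ (u≢u , _) → u≢u refl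
  }

-- Not necessarily induced: edge may be any symmetric part of the adjacency
-- relation of H with both endpoints in verts.
record Subgraph {n} (H : Graph n) : Set₁ where
  field
    verts      : Subset n
    edge       : Rel (Fin n) 0ℓ
    edge-sym   : Symmetric edge
    edge-verts : ∀ {u v} → edge u v → u ∈ verts × v ∈ verts
    edge-adj   : ∀ {u v} → edge u v → Adj H u v

  Vertex : Set
  Vertex = ∃ (_∈ verts)

record _≅_ {k n} (G : Graph k) {H : Graph n} (S : Subgraph H) : Set where
  open Subgraph S
  field
    bijection : Fin k ↔ Vertex

  ⟦_⟧ : Fin k → Fin n
  ⟦ u ⟧ = proj₁ (Inverse.to bijection u)

  field
    adj⇔edge : ∀ {u v} → Adj G u v ⇔ edge ⟦ u ⟧ ⟦ v ⟧

_Contains_ : ∀ {n k} → Graph n → Graph k → Set₁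
H Contains G = ∃ λ (S : Subgraph H) → G ≅ S

-- The irrelevant argument makes the colour depend only on the endpoints, and
-- colour-sym makes it independent of their order.
record EdgeColouring {n} (G : Graph n) (c : ℕ) : Set where
  field
    colour     : ∀ u v → .(Adj G u v) → Fin c
    colour-sym : ∀ {u v} (e : Adj G u v) →
                 colour u v e ≡ colour v u (adj-sym G e)

open EdgeColouring

colourClass : ∀ {n c} {G : Graph n} → EdgeColouring G c → Fin c → Graph n
colourClass {G = G} χ i = record
  { Adj        = λ u v → ∃ λ (e : Adj G u v) → colour χ u v e ≡ i
  ; adj-sym    = λ (e , p) → adj-sym G e , trans (sym (colour-sym χ e)) p
  ; adj-irrefl = λ (e , _) → adj-irrefl G e
  }

Forces₃ : ∀ {k} → ℕ → Graph k → Set₁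
Forces₃ N G = (χ : EdgeColouring (complete N) 3) →
              ∃ λ i → colourClass χ i Contains G

-- R₃(G) = N, expressed as a relation so that the existence of a Ramsey number
-- for every G is not presupposed.
R₃[_]≡_ : ∀ {k} → Graph k → ℕ → Set₁
R₃[ G ]≡ N = Forces₃ N G × (∀ M → Forces₃ M G → N ≤ M)

{-# OPTIONS --safe #-}

-- Upper bound.  Let C be a cycle on 2n vertices of colour c in a colouring of
-- K₄ₙ₊₁ without monochromatic P₂ₙ₊₁.  No edge of colour c leaves C.  Every
-- 2n-cycle D has colour c too: otherwise all edges between C ∩ D and the
-- complement of C ∪ D, and between C ∖ D and D ∖ C, have the third colour, and
-- one of these bicliques contains K_{n,n+1}.  Contract a vertex x₀ of C with a
-- vertex y outside C: the new vertex z sees C through y and the rest through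
-- x₀, so no edge at z has colour c.  By hypothesis the contracted K₄ₙ has a
-- monochromatic 2n-cycle.  If it passes through z, its colour is not c, and it
-- lifts to a 2n-cycle or, when the neighbours of z lie on different sides of
-- C, to a P₂ₙ₊₁ from x₀ to y.  Hence it avoids z, so it is a 2n-cycle D of
-- colour c disjoint from C and avoiding y.  Taking y on D yields another such
-- cycle E avoiding y, which can neither lie inside D, nor be disjoint from
-- C ∪ D, nor cross D.
--
-- Lower bound.  Split 4n vertices into four blocks of size n and colour the
-- edges between blocks by the perfect matchings of K₄: monochromatic
-- components have at most 2n vertices.
module Submission where

open import Defs
open import Data.Bool.Base using (true)
open import Data.Fin.Base
  using (Fin; zero; suc; toℕ; fromℕ; inject₁; inject≤; punchIn; combine; remQuot)
open import Data.Fin.Induction using (<-weakInduction)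
open import Data.Fin.Patterns using (0F; 1F; 2F)
open import Data.Fin.Properties
  using (_≟_; all?; any?; toℕ-fromℕ; toℕ-inject₁;
         injective⇒≤; inject≤-injective; punchIn-injective; punchInᵢ≢i;
         combine-injective; combine-remQuot)
open import Data.List.Base
  using (List; []; map; _∷_; _++_; _∷ʳ_; length; filter; take; tabulate; lookup; allFin)
open import Data.List.Membership.DecPropositional using (_∈?_)
open import Data.List.Membership.Propositional using (_∈_; _∉_)
open import Data.List.Membership.Propositional.Properties
  using (∈-++⁺ˡ; ∈-++⁻; ∈-lookup; ∈-filter⁺; ∈-filter⁻; ∈-allFin; ∈-map⁻)
import Data.List.Membership.Setoid.Properties as SetoidMembership
open import Data.List.Properties
  using (++-assoc; ++-identityʳ; length-++; length-map; map-++; length-take; length-tabulate;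
         take++drop≡id)
open import Data.List.Relation.Binary.Permutation.Propositional
  using (_↭_; ↭-refl; ↭-sym; ↭-trans; prep; ↭⇒↭ₛ; ↭-reflexive)
open import Data.List.Relation.Binary.Permutation.Propositional.Properties
  using (∈-resp-↭; ↭-length; ∷↭∷ʳ; ++-comm)
import Data.List.Relation.Binary.Permutation.Setoid.Properties as SetoidPermutation
open import Data.List.Relation.Binary.Subset.Propositional using (_⊆_)
open import Data.List.Relation.Unary.All as All using (_∷_)
open import Data.List.Relation.Unary.All.Properties using (¬Any⇒All¬)
open import Data.List.Relation.Unary.AllPairs using (_∷_)
open import Data.List.Relation.Unary.Any using (here; there)
open import Data.List.Relation.Unary.Linked as Linked
  using (Linked; []; [-]; _∷_)
open import Data.List.Relation.Unary.Unique.Propositional using (Unique)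
import Data.List.Relation.Unary.Linked.Properties as Linkedₚ
import Data.List.Relation.Unary.Unique.Propositional.Properties as Uniqueₚ
open Uniqueₚ
  using (++⁺; take⁺; filter⁺; tabulate⁺; allFin⁺; Unique[x∷xs]⇒x∉xs)
open import Data.Nat.Base using (ℕ; zero; suc; _+_; _*_; _≤_; _<_; z≤n; s≤s)
open import Data.Nat.Properties as ℕ
  using (+-comm; +-suc; +-cancelˡ-≤; +-monoˡ-≤; ≤-trans; ≤-reflexive; ≤-refl)
open import Data.Nat.Tactic.RingSolver using (solve-∀)
open import Data.Product.Base using (∃; ∃₂; _×_; _,_; -,_; proj₁; proj₂; uncurry)
open import Data.Sum.Base using (_⊎_; inj₁; inj₂; [_,_]′)
open import Data.Vec.Base as Vec using ()
open import Data.Vec.Properties using ([]=⇒lookup; lookup⇒[]=; lookup∘tabulate)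
open import Data.Vec.Properties.WithK using ([]=-irrelevant)
open import Function.Base using (_∘_; id; case_of_)
open import Function.Bundles using (mk↔ₛ′; mk⇔; module Inverse; module Equivalence)
open import Function.Definitions using (Injective)
open import Level using (0ℓ)
open import Relation.Binary.Core using (Rel; _⇒_)
open import Relation.Binary.Definitions using (Symmetric)
open import Relation.Binary.PropositionalEquality
open import Relation.Nullary.Decidable
  using (Dec; yes; no; does; dec-true; toWitness; ¬?; _×-dec_; _→-dec_)
open import Relation.Nullary.Negation using (¬_; contradiction)
open import Relation.Unary using (Pred; Decidable)
open import Relation.Unary.Properties using (∁?)

open Graph
open EdgeColouring

private
  variable
    A : Set
    xs ys : List A

-- Duplicate-free and linked lists

Unique-resp-↭ : xs ↭ ys → Unique xs → Unique ys
Unique-resp-↭ p = SetoidPermutation.Unique-resp-↭ (setoid _) (↭⇒↭ₛ p)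

∉⇒Unique-∷ : ∀ {x : A} → x ∉ xs → Unique xs → Unique (x ∷ xs)
∉⇒Unique-∷ x∉xs u = ¬Any⇒All¬ _ x∉xs ∷ u

lookup-injective : Unique xs → Injective _≡_ _≡_ (lookup xs)
lookup-injective (_ ∷ _)  {zero}  {zero}  _  = refl
lookup-injective (x∉ ∷ _) {zero}  {suc j} eq = contradiction eq (All.lookup x∉ (∈-lookup j))
lookup-injective (x∉ ∷ _) {suc i} {zero}  eq = contradiction (sym eq) (All.lookup x∉ (∈-lookup i))
lookup-injective (_ ∷ u)  {suc i} {suc j} eq = cong suc (lookup-injective u eq)

-- Pigeonhole: the index in `ys` of an entry of `xs` determines the entry, and `Unique xs` then
-- determines its position.
Unique-⊆⇒length≤ : Unique xs → xs ⊆ ys → length xs ≤ length ys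
Unique-⊆⇒length≤ {xs = xs} u xs⊆ys = injective⇒≤ λ {i} {j} eq →
  lookup-injective u (SetoidMembership.index-injective (setoid _)
    (xs⊆ys (∈-lookup i)) (xs⊆ys (∈-lookup j)) eq)

_∈ᶠ?_ : ∀ {n} (v : Fin n) xs → Dec (v ∈ xs)
_∈ᶠ?_ = _∈?_ _≟_

-- Otherwise `v` could be prepended to `xs`, giving a duplicate-free list inside `ys` that is longer
-- than `ys`.
Unique-⊆⇒∈ : ∀ {n v} {xs ys : List (Fin n)} → Unique xs → xs ⊆ ys →
             length ys ≤ length xs → v ∈ ys → v ∈ xs
Unique-⊆⇒∈ {v = v} {xs} u xs⊆ys p v∈ys with v ∈ᶠ? xs
... | yes v∈xs = v∈xs
... | no  v∉xs = contradiction
  (≤-trans (s≤s p) (Unique-⊆⇒length≤ (∉⇒Unique-∷ v∉xs u)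
    λ { (here refl) → v∈ys ; (there w∈) → xs⊆ys w∈ }))
  ℕ.1+n≰n

length-filter-∁ : {P : Pred A 0ℓ} (P? : Decidable P) (xs : List A) →
                  length (filter P? xs) + length (filter (∁? P?) xs) ≡ length xs
length-filter-∁ P? []       = refl
length-filter-∁ P? (x ∷ xs) with P? x
... | yes _ = cong suc (length-filter-∁ P? xs)
... | no  _ = trans (+-suc _ _) (cong suc (length-filter-∁ P? xs))

-- Opaque so that xs and ys can be inferred from xs ∩ ys and xs ∖ ys.
opaque
  _∩_ _∖_ : ∀ {n} → List (Fin n) → List (Fin n) → List (Fin n)
  xs ∩ ys = filter (_∈ᶠ? ys) xs
  xs ∖ ys = filter (∁? (_∈ᶠ? ys)) xs

  ∈-∩⁺ : ∀ {n v} {xs ys : List (Fin n)} → v ∈ xs → v ∈ ys → v ∈ xs ∩ ys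
  ∈-∩⁺ {ys = ys} = ∈-filter⁺ (_∈ᶠ? ys)

  ∈-∩⁻ : ∀ {n v} {xs ys : List (Fin n)} → v ∈ xs ∩ ys → v ∈ xs × v ∈ ys
  ∈-∩⁻ {ys = ys} = ∈-filter⁻ (_∈ᶠ? ys)

  ∈-∖⁺ : ∀ {n v} {xs ys : List (Fin n)} → v ∈ xs → v ∉ ys → v ∈ xs ∖ ys
  ∈-∖⁺ {ys = ys} = ∈-filter⁺ (∁? (_∈ᶠ? ys))

  ∈-∖⁻ : ∀ {n v} {xs ys : List (Fin n)} → v ∈ xs ∖ ys → v ∈ xs × v ∉ ys
  ∈-∖⁻ {ys = ys} = ∈-filter⁻ (∁? (_∈ᶠ? ys))

  ∩-Unique : ∀ {n} {xs ys : List (Fin n)} → Unique xs → Unique (xs ∩ ys)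
  ∩-Unique {ys = ys} = filter⁺ (_∈ᶠ? ys)

  ∖-Unique : ∀ {n} {xs ys : List (Fin n)} → Unique xs → Unique (xs ∖ ys)
  ∖-Unique {ys = ys} = filter⁺ (∁? (_∈ᶠ? ys))

  length-∩-∖ : ∀ {n} (xs ys : List (Fin n)) → length (xs ∩ ys) + length (xs ∖ ys) ≡ length xs
  length-∩-∖ xs ys = length-filter-∁ (_∈ᶠ? ys) xs

take-⊆ : ∀ k → take k xs ⊆ xs
take-⊆ {xs = xs} k x∈ = subst (_ ∈_) (take++drop≡id k xs) (∈-++⁺ˡ x∈)

module _ {R S : Rel A 0ℓ} where

  -- The membership premises matter for `Linked-col*`, where the two colourings agree only away from
  -- `x₀`.
  Linked-map-∈ : (∀ {u v} → u ∈ xs → v ∈ xs → R u v → S u v) → Linked R xs → Linked S xs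
  Linked-map-∈ f []      = []
  Linked-map-∈ f [-]     = [-]
  Linked-map-∈ f (r ∷ l) =
    f (here refl) (there (here refl)) r ∷ Linked-map-∈ (λ u∈ v∈ → f (there u∈) (there v∈)) l

module _ {R : Rel A 0ℓ} where

  Linked-∷ʳ : ∀ {x y} xs → Linked R (xs ∷ʳ x) → R x y → Linked R (xs ∷ʳ x ∷ʳ y)
  Linked-∷ʳ []           _       r = r ∷ [-]
  Linked-∷ʳ (_ ∷ [])     (s ∷ l) r = s ∷ Linked-∷ʳ [] l r
  Linked-∷ʳ (_ ∷ _ ∷ xs) (s ∷ l) r = s ∷ Linked-∷ʳ (_ ∷ xs) l r

  Linked-join : ∀ {x y z} xs → Linked R (x ∷ z ∷ xs) → Linked R ((z ∷ xs) ∷ʳ y) →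
                Linked R (x ∷ (z ∷ xs) ∷ʳ y)
  Linked-join _ (r ∷ _) l = r ∷ l

  Linked-tabulate : ∀ {m} (f : Fin (suc m) → A) →
                    (∀ i → R (f (inject₁ i)) (f (suc i))) → Linked R (tabulate f)
  Linked-tabulate {zero}  f r = [-]
  Linked-tabulate {suc m} f r = r zero ∷ Linked-tabulate (f ∘ suc) (r ∘ suc)

  Linked-tabulate-∷ʳ : ∀ {m y} (f : Fin (suc m) → A) →
                       (∀ i → R (f (inject₁ i)) (f (suc i))) → R (f (fromℕ m)) y →
                       Linked R (tabulate f ∷ʳ y)
  Linked-tabulate-∷ʳ {zero}  f r s = s ∷ [-]
  Linked-tabulate-∷ʳ {suc m} f r s = r zero ∷ Linked-tabulate-∷ʳ (f ∘ suc) (r ∘ suc) s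

  Linked-lookup : ∀ {xs} → Linked R xs → ∀ i j → toℕ j ≡ suc (toℕ i) →
                  R (lookup xs i) (lookup xs j)
  Linked-lookup (r ∷ _) zero    (suc zero) _  = r
  Linked-lookup (_ ∷ l) (suc i) (suc j)    eq = Linked-lookup l i j (ℕ.suc-injective eq)

-- Alternates by swapping the arguments and stops when the list whose turn it is runs out. Leftovers
-- of the other list are lost, hence the length bounds in `zigzag-↭`, which trade places at each
-- swap.
zigzag : List A → List A → List A
zigzag []       ys = []
zigzag (x ∷ xs) ys = x ∷ zigzag ys xs

zigzag-↭ : ∀ (xs ys : List A) → length ys ≤ length xs → length xs ≤ suc (length ys) →
           zigzag xs ys ↭ xs ++ ys
zigzag-↭ []       []  _ _       = ↭-refl
zigzag-↭ (x ∷ xs) ys  p (s≤s q) = prep x (↭-trans (zigzag-↭ ys xs q p) (++-comm ys xs))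

zigzag-Linked : {R : Rel A 0ℓ} → Symmetric R → ∀ xs ys →
                (∀ {x y} → x ∈ xs → y ∈ ys → R x y) → Linked R (zigzag xs ys)
zigzag-Linked s []       ys       r = []
zigzag-Linked s (x ∷ xs) []       r = [-]
zigzag-Linked s (x ∷ xs) (y ∷ ys) r =
  r (here refl) (here refl) ∷
  zigzag-Linked s (y ∷ ys) xs (λ y∈ x∈ → s (r (there x∈) y∈))

-- Paths and cycles in a relation

record IsPath (R : Rel A 0ℓ) (xs : List A) : Set where
  field
    unique : Unique xs
    linked : Linked R xs

-- Two overlapping halves of the closed walk, so that the two ends at x can be
-- moved to another vertex independently.
record IsCycle (R : Rel A 0ℓ) (x : A) (xs : List A) : Set where
  field
    unique : Unique (x ∷ xs)
    front  : Linked R (x ∷ xs)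
    back   : Linked R (xs ∷ʳ x)

open IsCycle

HasPath : ℕ → Rel A 0ℓ → Set
HasPath k R = ∃ λ xs → length xs ≡ k × IsPath R xs

rotate₁ : {R : Rel A 0ℓ} → ∀ {x w ws} → IsCycle R x (w ∷ ws) → IsCycle R w (ws ∷ʳ x)
rotate₁ {x = x} {w} {ws} c = record
  { unique = Unique-resp-↭ (∷↭∷ʳ x _) (unique c)
  ; front  = back c
  ; back   = Linked-∷ʳ ws (Linked.tail (back c)) (Linked.head (front c))
  }

-- The recursion is on `ws`, the stretch where `y` may still lie; `vs` collects the starting points
-- already passed.
rotate : {R : Rel A 0ℓ} → ∀ {x y} ws vs → y ∈ x ∷ ws → IsCycle R x (ws ++ vs) →
         ∃ λ zs → IsCycle R y zs × x ∷ ws ++ vs ↭ y ∷ zs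
rotate ws vs (here refl) c = ws ++ vs , c , ↭-refl
rotate {R = R} {x = x} (w ∷ ws) vs (there y∈) c
  with zs , c′ , p ← rotate ws (vs ∷ʳ x) y∈
                       (subst (IsCycle R w) (++-assoc ws vs (x ∷ [])) (rotate₁ c))
  = zs , c′ , ↭-trans (∷↭∷ʳ x (w ∷ ws ++ vs))
                (↭-trans (↭-reflexive (cong (w ∷_) (++-assoc ws vs (x ∷ [])))) p)

rotateTo : {R : Rel A 0ℓ} → ∀ {x y ws} → y ∈ x ∷ ws → IsCycle R x ws →
           ∃ λ zs → IsCycle R y zs × x ∷ ws ↭ y ∷ zs
rotateTo {R = R} {x} {y} {ws} y∈ c
  with zs , c′ , p ← rotate ws [] y∈ (subst (IsCycle R x) (sym (++-identityʳ ws)) c)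
  = zs , c′ , ↭-trans (↭-reflexive (cong (x ∷_) (sym (++-identityʳ ws)))) p

Separated : Rel A 0ℓ → List A → Set
Separated R xs = ∀ {u v} → u ∈ xs → v ∉ xs → ¬ R u v

module _ {R : Rel A 0ℓ} (R-sym : Symmetric R) where

  -- Rotating the cycle to start at `u` and dropping its closing edge leaves a path from `u`, to
  -- which `v` is prepended.
  cycle+edge⇒path : ∀ {x ws u v} → IsCycle R x ws → u ∈ x ∷ ws → v ∉ x ∷ ws → R u v →
                    HasPath (suc (length (x ∷ ws))) R
  cycle+edge⇒path c u∈ v∉ r with zs , c′ , p ← rotateTo u∈ c =
    _ ∷ _ ∷ zs , cong suc (↭-length (↭-sym p)) , record
      { unique = ∉⇒Unique-∷ (v∉ ∘ ∈-resp-↭ (↭-sym p)) (unique c′)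
      ; linked = R-sym r ∷ front c′
      }

  -- After trimming the sides to `n + 1` and `n` vertices, the alternating list starts and ends on
  -- the larger side and uses every remaining vertex.
  biclique⇒path : ∀ n {xs ys} → Unique xs → Unique ys → (∀ {x} → x ∈ xs → x ∉ ys) →
                  (∀ {x y} → x ∈ xs → y ∈ ys → R x y) →
                  suc n ≤ length xs → n ≤ length ys → HasPath (suc n + n) R
  biclique⇒path n {xs} {ys} u v disj r p q = zigzag xs′ ys′ , len , record
    { unique = Unique-resp-↭ (↭-sym perm)
        (++⁺ (take⁺ (suc n) u) (take⁺ n v)
          λ (x∈ , x∈′) → disj (take-⊆ (suc n) x∈) (take-⊆ n x∈′))
    ; linked = zigzag-Linked R-sym xs′ ys′ λ x∈ y∈ → r (take-⊆ (suc n) x∈) (take-⊆ n y∈)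
    }
    where
    xs′ ys′ : List _
    xs′ = take (suc n) xs
    ys′ = take n ys
    ∣xs′∣ : length xs′ ≡ suc n
    ∣xs′∣ = trans (length-take (suc n) xs) (ℕ.m≤n⇒m⊓n≡m p)
    ∣ys′∣ : length ys′ ≡ n
    ∣ys′∣ = trans (length-take n ys) (ℕ.m≤n⇒m⊓n≡m q)
    perm : zigzag xs′ ys′ ↭ xs′ ++ ys′
    perm = zigzag-↭ xs′ ys′
      (subst₂ _≤_ (sym ∣ys′∣) (sym ∣xs′∣) (ℕ.n≤1+n n))
      (subst₂ _≤_ (sym ∣xs′∣) (cong suc (sym ∣ys′∣)) ≤-refl)
    len : length (zigzag xs′ ys′) ≡ suc n + n
    len = trans (↭-length perm) (trans (length-++ xs′) (cong₂ _+_ ∣xs′∣ ∣ys′∣))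

  -- Membership in `xs` propagates along each edge, and by symmetry of `R` so does non-membership;
  -- the first vertex decides.
  Separated⇒dichotomy : ∀ {xs x ws} → (∀ v → Dec (v ∈ xs)) → Separated R xs → Linked R (x ∷ ws) →
                        x ∷ ws ⊆ xs ⊎ (∀ {v} → v ∈ x ∷ ws → v ∉ xs)
  Separated⇒dichotomy {xs} {x} dec sep l with dec x
  ... | yes x∈ = inj₁ (inside x∈ l)
    where
    inside : ∀ {x ws} → x ∈ xs → Linked R (x ∷ ws) → x ∷ ws ⊆ xs
    inside x∈ _       (here refl) = x∈
    inside x∈ (r ∷ l) (there v∈) with dec _
    ... | yes y∈ = inside y∈ l v∈
    ... | no  y∉ = contradiction r (sep x∈ y∉)
  ... | no  x∉ = inj₂ (outside x∉ l)
    where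
    outside : ∀ {x ws} → x ∉ xs → Linked R (x ∷ ws) → ∀ {v} → v ∈ x ∷ ws → v ∉ xs
    outside x∉ _       (here refl) = x∉
    outside x∉ (r ∷ l) (there v∈) with dec _
    ... | yes y∈ = contradiction (R-sym r) (sep y∈ x∉)
    ... | no  y∉ = outside y∉ l v∈

-- Embeddings of graphs

record Embedding {k n} (G : Graph k) (H : Graph n) : Set where
  field
    to        : Fin k → Fin n
    injective : Injective _≡_ _≡_ to
    map-adj   : ∀ {i j} → Adj G i j → Adj H (to i) (to j)

open Embedding

Contains⇒Embedding : ∀ {k n} {G : Graph k} {H : Graph n} → H Contains G → Embedding G H
Contains⇒Embedding {G = G} {H} (S , G≅S) = record
  { to        = ⟦_⟧
  ; injective = λ {i} {j} eq → injective′ (vertex-≡ eq)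
  ; map-adj   = edge-adj ∘ Equivalence.to adj⇔edge
  }
  where
  open Subgraph S
  open _≅_ G≅S
  vertex-≡ : ∀ {u v : Vertex} → proj₁ u ≡ proj₁ v → u ≡ v
  vertex-≡ {_ , p} {_ , q} refl = cong (_ ,_) ([]=-irrelevant p q)
  injective′ : ∀ {i j} → Inverse.to bijection i ≡ Inverse.to bijection j → i ≡ j
  injective′ eq = trans (sym (Inverse.strictlyInverseʳ bijection _))
    (trans (cong (Inverse.from bijection) eq) (Inverse.strictlyInverseʳ bijection _))

-- The subgraph has only the images of edges of `G`, not all edges of `H` between image vertices;
-- otherwise `adj⇔edge` could fail from right to left.
Embedding⇒Contains : ∀ {k n} {G : Graph k} {H : Graph n} → Embedding G H → H Contains G
Embedding⇒Contains {k} {n} {G} {H} f = S , record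
  { bijection = mk↔ₛ′ (λ i → to f i , in-image i) (proj₁ ∘ preimage) to∘from from∘to
  ; adj⇔edge  = mk⇔ (λ a → _ , _ , a , refl , refl) from-edge
  }
  where
  image? : ∀ v → Dec (∃ λ i → to f i ≡ v)
  image? v = any? λ i → to f i ≟ v
  image = Vec.tabulate (does ∘ image?)
  in-image : ∀ i → image Vec.[ to f i ]= true
  in-image i = lookup⇒[]= _ _
    (trans (lookup∘tabulate (does ∘ image?) _) (dec-true (image? _) (i , refl)))
  preimage : ∀ (v : ∃ λ v → image Vec.[ v ]= true) → ∃ λ i → to f i ≡ proj₁ v
  preimage (v , v∈) with image? v | trans (sym (lookup∘tabulate (does ∘ image?) v)) ([]=⇒lookup v∈)
  ... | yes p | _ = p
  ... | no  _ | ()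
  to∘from : ∀ v → (to f (proj₁ (preimage v)) , in-image (proj₁ (preimage v))) ≡ v
  to∘from v with preimage v
  to∘from (_ , v∈) | i , refl = cong (_ ,_) ([]=-irrelevant _ _)
  from∘to : ∀ i → proj₁ (preimage (to f i , in-image i)) ≡ i
  from∘to i = injective f (proj₂ (preimage (to f i , in-image i)))
  S : Subgraph H
  S = record
    { verts      = image
    ; edge       = λ u v → ∃₂ λ i j → Adj G i j × u ≡ to f i × v ≡ to f j
    ; edge-sym   = λ (i , j , a , p , q) → j , i , adj-sym G a , q , p
    ; edge-verts = λ { (i , j , _ , refl , refl) → in-image i , in-image j }
    ; edge-adj   = λ { (i , j , a , refl , refl) → map-adj f a }
    }
  from-edge : ∀ {i j} → Subgraph.edge S (to f i) (to f j) → Adj G i j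
  from-edge (_ , _ , a , p , q) = subst₂ (Adj G) (sym (injective f p)) (sym (injective f q)) a

-- The premise `u ≢ v` admits relations that may hold on the diagonal, such as `Mono col d`;
-- injectivity of `lookup` supplies it.
IsPath⇒Embedding : ∀ {k n} {R : Rel (Fin n) 0ℓ} (H : Graph n) →
                   (∀ {u v} → u ≢ v → R u v → Adj H u v) →
                   HasPath k R → Embedding (path k) H
IsPath⇒Embedding {R = R} H R⇒Adj (xs , refl , p) = record
  { to        = lookup xs
  ; injective = lookup-injective unique′
  ; map-adj   = λ where
      (inj₁ eq) → step eq
      (inj₂ eq) → adj-sym H (step eq)
  }
  where
  open IsPath p renaming (unique to unique′)
  step : ∀ {i j} → toℕ j ≡ suc (toℕ i) → Adj H (lookup xs i) (lookup xs j)
  step {i} {j} eq = R⇒Adj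
    (λ eq′ → ℕ.1+n≢n (trans (sym eq) (cong toℕ (sym (lookup-injective unique′ eq′)))))
    (Linked-lookup linked i j eq)

Embedding⇒IsCycle : ∀ {k n} {R : Rel (Fin n) 0ℓ} (H : Graph n) → Adj H ⇒ R → 2 ≤ k →
                    Embedding (cycle k) H → ∃₂ λ x xs → IsCycle R x xs × length (x ∷ xs) ≡ k
Embedding⇒IsCycle {R = R} H Adj⇒R (s≤s (s≤s {n = m} z≤n)) f =
  to f zero , tabulate (to f ∘ suc) , cyc , cong suc (length-tabulate (to f ∘ suc))
  where
  step : ∀ i → R (to f (inject₁ i)) (to f (suc i))
  step i = Adj⇒R (map-adj f
    ( (λ eq → ℕ.1+n≢n (trans (sym (cong toℕ eq)) (toℕ-inject₁ i)))
    , inj₁ (inj₁ (cong suc (sym (toℕ-inject₁ i))))))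
  -- `2 ≤ k` makes the last index a successor, hence distinct from `zero`, as adjacency in `cycle`
  -- demands.
  close : R (to f (fromℕ (suc m))) (to f zero)
  close = Adj⇒R (map-adj f
    ((λ ()) , inj₁ (inj₂ (cong suc (toℕ-fromℕ (suc m)) , refl))))
  cyc : IsCycle R (to f zero) (tabulate (to f ∘ suc))
  cyc = record
    { unique = tabulate⁺ (injective f)
    ; front  = Linked-tabulate (to f) step
    ; back   = Linked-tabulate-∷ʳ (to f ∘ suc) (step ∘ suc) close
    }

-- Monochromatic cycles and paths

-- Colours all ordered pairs, so that no proof of `u ≢ v` has to be carried along when vertices are
-- renamed, as in `avoiding` and `Contraction`.
Colouring : ℕ → Set
Colouring n = Fin n → Fin n → Fin 3

ColourSym : ∀ {n} → Colouring n → Set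
ColourSym col = ∀ u v → col u v ≡ col v u

Mono : ∀ {n} → Colouring n → Fin 3 → Rel (Fin n) 0ℓ
Mono col d u v = col u v ≡ d

MonoCycle : ∀ {n} → ℕ → Colouring n → Fin 3 → Fin n → List (Fin n) → Set
MonoCycle k col d x xs = IsCycle (Mono col d) x xs × length (x ∷ xs) ≡ k

MonoPath : ∀ {n} → ℕ → Colouring n → Set
MonoPath k col = ∃ λ d → HasPath k (Mono col d)

CycleRamsey : ℕ → ℕ → Set
CycleRamsey k n = ∀ (col : Colouring n) → ColourSym col →
                  ∃ λ d → ∃₂ λ x xs → MonoCycle k col d x xs

Forces₃⇒CycleRamsey : ∀ {k n} → 2 ≤ k → Forces₃ n (cycle k) → CycleRamsey k n
Forces₃⇒CycleRamsey 2≤k forces col col-sym = d ,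
  Embedding⇒IsCycle (colourClass χ d) proj₂ 2≤k (Contains⇒Embedding (proj₂ (forces χ)))
  where
  χ : EdgeColouring (complete _) 3
  χ = record { colour = λ u v _ → col u v ; colour-sym = λ _ → col-sym _ _ }
  d = proj₁ (forces χ)

PathRamsey⇒Forces₃ : ∀ {k n} → (∀ (col : Colouring n) → ColourSym col → MonoPath k col) →
                     Forces₃ n (path k)
PathRamsey⇒Forces₃ ramsey χ =
  let d , p = ramsey col col-sym in
  d , Embedding⇒Contains (IsPath⇒Embedding (colourClass χ d)
        (λ u≢v eq → u≢v , trans (sym (col-≢ u≢v)) eq) p)
  where
  col : Colouring _
  col u v with u ≟ v
  -- An arbitrary default on the diagonal, which a duplicate-free path never meets.
  ... | yes _  = 0F
  ... | no u≢v = colour χ u v u≢v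
  col-≢ : ∀ {u v} (u≢v : u ≢ v) → col u v ≡ colour χ u v u≢v
  col-≢ {u} {v} u≢v with u ≟ v
  ... | yes u≡v = contradiction u≡v u≢v
  ... | no  _   = refl
  col-sym : ColourSym col
  col-sym u v with u ≟ v | v ≟ u
  ... | yes _   | yes _   = refl
  ... | yes u≡v | no v≢u  = contradiction (sym u≡v) v≢u
  ... | no u≢v  | yes v≡u = contradiction (sym v≡u) u≢v
  ... | no u≢v  | no v≢u  = colour-sym χ u≢v

-- The upper bound

thirdColour : ∀ (c d : Fin 3) → c ≢ d → ∃ λ e → ∀ x → x ≢ c → x ≢ d → x ≡ e
thirdColour = toWitness {a? = all? λ c → all? λ d → ¬? (c ≟ d) →-dec
  any? λ e → all? λ x → ¬? (x ≟ c) →-dec (¬? (x ≟ d) →-dec x ≟ e)} _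

-- Deleting `y` leaves a complete graph on `n` vertices, and `punchIn y` carries the cycle found
-- there back.
avoiding : ∀ {k n} → CycleRamsey k n → (col : Colouring (suc n)) → ColourSym col → ∀ y →
           ∃ λ d → ∃₂ λ x xs → MonoCycle k col d x xs × y ∉ x ∷ xs
avoiding ramsey col col-sym y
  with d , x , xs , c , len ← ramsey (λ u v → col (punchIn y u) (punchIn y v))
                                (λ _ _ → col-sym _ _)
  = d , punchIn y x , map (punchIn y) xs , (record
      { unique = Uniqueₚ.map⁺ (punchIn-injective y _ _) (unique c)
      ; front  = Linkedₚ.map⁺ (front c)
      ; back   = subst (Linked _) (map-++ (punchIn y) xs (x ∷ [])) (Linkedₚ.map⁺ (back c))
      } , trans (length-map (punchIn y) (x ∷ xs)) len) ,
    λ y∈ → case ∈-map⁻ (punchIn y) {xs = x ∷ xs} y∈ of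
             λ (_ , _ , eq) → punchInᵢ≢i y _ (sym eq)

-- Serves as a lower bound on `b`: a whole of size at least `x + y` with one part of size at most
-- `x` leaves at least `y` for the other part.
a≤x⇒y≤b : ∀ {a b x y} → a ≤ x → x + y ≤ a + b → y ≤ b
a≤x⇒y≤b {b = b} {x} a≤x p = +-cancelˡ-≤ x _ _ (≤-trans p (+-monoˡ-≤ b a≤x))

module UpperBound (n : ℕ) (0<n : 0 < n) (ramsey : CycleRamsey (2 * n) (4 * n)) where

  private
    Vertex : Set
    Vertex = Fin (suc (4 * n))

    2n≡n+n : 2 * n ≡ n + n
    2n≡n+n = cong (n +_) (ℕ.+-identityʳ n)

    MonoPath′ : Colouring (suc (4 * n)) → Set
    MonoPath′ = MonoPath (suc (2 * n))

  module _ (col : Colouring (suc (4 * n))) (col-sym : ColourSym col) where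

    private
      Mono-sym : ∀ {d} → Symmetric (Mono col d)
      Mono-sym {x = u} {v} p = trans (col-sym v u) p

    -- An edge of colour `d` leaving the cycle extends it to a path on `2n + 1` vertices; a finite
    -- search decides whether there is one.
    separated : ∀ {d x xs} → MonoCycle (2 * n) col d x xs →
                MonoPath′ col ⊎ Separated (Mono col d) (x ∷ xs)
    separated {d} {x} {xs} (c , len)
      with any? (λ u → any? λ v → (u ∈ᶠ? (x ∷ xs)) ×-dec (¬? (v ∈ᶠ? (x ∷ xs)) ×-dec (col u v ≟ d)))
    ... | yes (u , v , u∈ , v∉ , p) = inj₁ (d , subst (λ k → HasPath (suc k) (Mono col d)) len
                                        (cycle+edge⇒path Mono-sym c u∈ v∉ p))
    ... | no ¬∃ = inj₂ λ u∈ v∉ p → ¬∃ (-, -, u∈ , v∉ , p)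

    -- Every edge of either biclique leaves both cycles, so it has neither colour. If the cycles
    -- share at least `n` vertices, at least `n + 1` vertices lie outside both; otherwise each cycle
    -- has at least `n + 1` vertices off the other.
    twoColours : ∀ {c d x xs y ys} → c ≢ d → MonoCycle (2 * n) col c x xs →
                 MonoCycle (2 * n) col d y ys → MonoPath′ col
    twoColours {c} {d} {x} {xs} {y} {ys} c≢d C D with separated C | separated D
    ... | inj₁ p | _      = p
    ... | inj₂ _ | inj₁ p = p
    ... | inj₂ sepC | inj₂ sepD = split (n ℕ.≤? length (ds ∩ cs))
      where
      cs = x ∷ xs
      ds = y ∷ ys
      vs = allFin (suc (4 * n))
      e = proj₁ (thirdColour c d c≢d)
      is-e : ∀ {u v} → col u v ≢ c → col u v ≢ d → col u v ≡ e
      is-e = proj₂ (thirdColour c d c≢d) _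
      biclique : ∀ {as bs} → Unique as → Unique bs → (∀ {v} → v ∈ as → v ∉ bs) →
                 (∀ {u v} → u ∈ as → v ∈ bs → col u v ≡ e) →
                 suc n ≤ length as → n ≤ length bs → MonoPath′ col
      biclique u v disj r p q = e , subst (λ k → HasPath (suc k) (Mono col e)) (sym 2n≡n+n)
        (biclique⇒path Mono-sym n u v disj r p q)
      uniqueC = unique (proj₁ C)
      uniqueD = unique (proj₁ D)
      unique-vs = allFin⁺ (suc (4 * n))
      ∣D∣ : length (ds ∩ cs) + length (ds ∖ cs) ≡ n + n
      ∣D∣ = trans (length-∩-∖ ds cs) (trans (proj₂ D) 2n≡n+n)
      ∣C∣ : length (cs ∩ ds) + length (cs ∖ ds) ≡ n + n
      ∣C∣ = trans (length-∩-∖ cs ds) (trans (proj₂ C) 2n≡n+n)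
      ∣V∣ : length (vs ∩ cs) + length (vs ∖ cs) ≡ suc (4 * n)
      ∣V∣ = trans (length-∩-∖ vs cs) (length-tabulate id)
      split : Dec (n ≤ length (ds ∩ cs)) → MonoPath′ col
      split (yes p) = biclique (∖-Unique (∖-Unique unique-vs)) (∩-Unique uniqueD)
        (λ v∈ v∈′ → proj₂ (∈-∖⁻ (proj₁ (∈-∖⁻ v∈))) (proj₂ (∈-∩⁻ v∈′)))
        (λ {u} {v} u∈ v∈ →
          let u∈vs∖cs , u∉ds = ∈-∖⁻ u∈
              u∉cs = proj₂ (∈-∖⁻ u∈vs∖cs)
              v∈ds , v∈cs = ∈-∩⁻ v∈
          in is-e (sepC v∈cs u∉cs ∘ trans (col-sym v u)) (sepD v∈ds u∉ds ∘ trans (col-sym v u)))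
        ∣out∣ p
        where
        ∣D∖C∣ : length (ds ∖ cs) ≤ n
        ∣D∖C∣ = +-cancelˡ-≤ n _ _ (≤-trans (+-monoˡ-≤ _ p) (≤-reflexive ∣D∣))
        ∣V∖C∣ : suc (n + n) ≤ length (vs ∖ cs)
        ∣V∖C∣ = a≤x⇒y≤b
          (≤-trans (Unique-⊆⇒length≤ (∩-Unique unique-vs) (proj₂ ∘ ∈-∩⁻)) (≤-reflexive (proj₂ C)))
          (≤-reflexive (trans (arith n) (sym ∣V∣)))
          where
          arith : ∀ n → 2 * n + suc (n + n) ≡ suc (4 * n)
          arith = solve-∀
        -- Of the at least `2n + 1` vertices outside `cs`, at most `n` lie on `ds`.
        ∣out∣ : suc n ≤ length ((vs ∖ cs) ∖ ds)
        ∣out∣ = a≤x⇒y≤b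
          (≤-trans (Unique-⊆⇒length≤ (∩-Unique (∖-Unique unique-vs))
            (λ v∈ → let v∈vs∖cs , v∈ds = ∈-∩⁻ v∈ in ∈-∖⁺ v∈ds (proj₂ (∈-∖⁻ v∈vs∖cs))))
            ∣D∖C∣)
          (≤-trans (≤-reflexive (+-suc n n))
            (≤-trans ∣V∖C∣ (≤-reflexive (sym (length-∩-∖ (vs ∖ cs) ds)))))
      split (no ¬p) = biclique (∖-Unique uniqueD) (∖-Unique uniqueC)
        (λ v∈ v∈′ → proj₂ (∈-∖⁻ v∈′) (proj₁ (∈-∖⁻ v∈)))
        (λ {u} {v} u∈ v∈ →
          let u∈ds , u∉cs = ∈-∖⁻ u∈
              v∈cs , v∉ds = ∈-∖⁻ v∈
          in is-e (sepC v∈cs u∉cs ∘ trans (col-sym v u)) (sepD u∈ds v∉ds))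
        (a≤x⇒y≤b (ℕ.≰⇒> ¬p) (bound (length (ds ∩ cs)) ∣D∣))
        (ℕ.<⇒≤ (a≤x⇒y≤b (≤-trans (s≤s ∣C∩D∣) (ℕ.≰⇒> ¬p)) (bound (length (cs ∩ ds)) ∣C∣)))
        where
        -- `cs ∩ ds` and `ds ∩ cs` may list the same vertices in different orders, so their lengths
        -- are compared by inclusion.
        ∣C∩D∣ : length (cs ∩ ds) ≤ length (ds ∩ cs)
        ∣C∩D∣ = Unique-⊆⇒length≤ (∩-Unique uniqueC)
          (λ v∈ → let v∈cs , v∈ds = ∈-∩⁻ v∈ in ∈-∩⁺ v∈ds v∈cs)
        bound : ∀ a {b} → a + b ≡ n + n → n + suc n ≤ suc a + b
        bound a eq = ≤-reflexive (trans (+-suc n n) (cong suc (sym eq)))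

    -- Recolours the edges from x₀ into xs as if they started at y.  After
    -- deleting y, the vertex x₀ stands for the contracted pair {x₀ , y}.
    module Contraction {c x₀ xs} (C : MonoCycle (2 * n) col c x₀ xs)
                       (sepC : Separated (Mono col c) (x₀ ∷ xs))
                       {y : Vertex} (y∉C : y ∉ x₀ ∷ xs) where

      private
        redirect : Vertex → Vertex → Vertex
        redirect u v with u ≟ x₀ | v ∈ᶠ? (x₀ ∷ xs)
        ... | yes _ | yes _ = y
        ... | yes _ | no _  = u
        ... | no _  | _     = u

        redirect-≢ : ∀ {u v} → u ≢ x₀ → redirect u v ≡ u
        redirect-≢ {u} {v} u≢x₀ with u ≟ x₀ | v ∈ᶠ? (x₀ ∷ xs)
        ... | yes u≡x₀ | _ = contradiction u≡x₀ u≢x₀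
        ... | no _     | _ = refl

        redirect-∈ : ∀ {v} → v ∈ x₀ ∷ xs → redirect x₀ v ≡ y
        redirect-∈ {v} v∈ with x₀ ≟ x₀ | v ∈ᶠ? (x₀ ∷ xs)
        ... | yes _ | yes _ = refl
        ... | yes _ | no v∉ = contradiction v∈ v∉
        ... | no ≢  | _     = contradiction refl ≢

        redirect-∉ : ∀ {v} → v ∉ x₀ ∷ xs → redirect x₀ v ≡ x₀
        redirect-∉ {v} v∉ with x₀ ≟ x₀ | v ∈ᶠ? (x₀ ∷ xs)
        ... | yes _ | yes v∈ = contradiction v∈ v∉
        ... | yes _ | no _   = refl
        ... | no ≢  | _      = contradiction refl ≢

        col* : Colouring (suc (4 * n))
        col* u v = col (redirect u v) (redirect v u)

        col*-≢ : ∀ {u v} → u ≢ x₀ → v ≢ x₀ → col* u v ≡ col u v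
        col*-≢ u≢ v≢ = cong₂ col (redirect-≢ u≢) (redirect-≢ v≢)

        Linked-col* : ∀ {d ws} → x₀ ∉ ws → Linked (Mono col* d) ws → Linked (Mono col d) ws
        Linked-col* x₀∉ = Linked-map-∈ λ u∈ v∈ → trans (sym (col*-≢
          (λ { refl → x₀∉ u∈ }) (λ { refl → x₀∉ v∈ })))

        -- In both cases the edge of `col` found here joins a vertex of the cycle to one outside it,
        -- which is what keeps colour `c` away from the contracted vertex.
        endpoint : ∀ {d v} → v ≢ x₀ → col* x₀ v ≡ d →
                   (v ∈ x₀ ∷ xs × col y v ≡ d) ⊎ (v ∉ x₀ ∷ xs × col x₀ v ≡ d)
        endpoint {d} {v} v≢ p = split (v ∈ᶠ? (x₀ ∷ xs))
          where
          split : Dec (v ∈ x₀ ∷ xs) → _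
          split (yes v∈) = inj₁ (v∈ , trans (sym (cong₂ col (redirect-∈ v∈) (redirect-≢ v≢))) p)
          split (no v∉)  = inj₂ (v∉ , trans (sym (cong₂ col (redirect-∉ v∉) (redirect-≢ v≢))) p)

        -- Records which of the two merged vertices an end of the arc attaches to; `extend` prepends
        -- or appends that vertex, so one definition serves both ends.
        EndsAt : Fin 3 → (Vertex → List Vertex) → Set
        EndsAt d extend = Linked (Mono col d) (extend x₀) ⊎ Linked (Mono col d) (extend y)

        frontEnd : ∀ {d w ws} → x₀ ∉ w ∷ ws → Linked (Mono col* d) (x₀ ∷ w ∷ ws) →
                   EndsAt d (_∷ w ∷ ws)
        frontEnd x₀∉ (p ∷ l) with endpoint (λ { refl → x₀∉ (here refl) }) p
        ... | inj₁ (_ , q) = inj₂ (q ∷ Linked-col* x₀∉ l)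
        ... | inj₂ (_ , q) = inj₁ (q ∷ Linked-col* x₀∉ l)

        backEnd : ∀ {d} w ws → x₀ ∉ w ∷ ws → Linked (Mono col* d) ((w ∷ ws) ∷ʳ x₀) →
                  EndsAt d ((w ∷ ws) ∷ʳ_)
        backEnd w [] x₀∉ (p ∷ _)
          with endpoint (λ { refl → x₀∉ (here refl) }) (trans (col-sym _ _) p)
        ... | inj₁ (_ , q) = inj₂ (Mono-sym q ∷ [-])
        ... | inj₂ (_ , q) = inj₁ (Mono-sym q ∷ [-])
        backEnd w (w′ ∷ ws) x₀∉ (p ∷ l) =
          [ inj₁ ∘ (q ∷_) , inj₂ ∘ (q ∷_) ]′ (backEnd w′ ws (x₀∉ ∘ there) l)
          where
          q = trans (sym (col*-≢ (λ { refl → x₀∉ (here refl) })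
                                 (λ { refl → x₀∉ (there (here refl)) }))) p

        x₀≢y : x₀ ≢ y
        x₀≢y refl = y∉C (here refl)

      -- The arc `z ∷ zs` keeps its colours in `col`, and each of its ends attaches to `x₀` or to
      -- `y`. Equal choices close a cycle of colour other than `c`; different choices give a path
      -- through both `x₀` and `y`, one vertex longer than the cycle.
      throughContracted : ∀ {d zs} → MonoCycle (2 * n) col* d x₀ zs → y ∉ zs → MonoPath′ col
      throughContracted {zs = []} (_ , len) _ = contradiction (trans len 2n≡n+n) (1≢n+n 0<n)
        where
        1≢n+n : ∀ {n} → 0 < n → 1 ≢ n + n
        1≢n+n {suc n} _ eq with () ← trans (ℕ.suc-injective eq) (+-suc n n)
      throughContracted {d} {z ∷ zs} (D , len) y∉ with d ≟ c
      -- For `d ≡ c` the first edge alone would be an edge of colour `c` leaving the cycle.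
      ... | yes refl with endpoint z≢x₀ (Linked.head (front D))
        where z≢x₀ = λ { refl → Unique[x∷xs]⇒x∉xs (unique D) (here refl) }
      ...   | inj₁ (z∈ , p) = contradiction (Mono-sym p) (sepC z∈ y∉C)
      ...   | inj₂ (z∉ , p) = contradiction p (sepC (here refl) z∉)
      throughContracted {d} {z ∷ zs} (D , len) y∉ | no d≢c =
        closing (frontEnd x₀∉ (front D)) (backEnd z zs x₀∉ (back D))
        where
        x₀∉ : x₀ ∉ z ∷ zs
        x₀∉ = Unique[x∷xs]⇒x∉xs (unique D)
        unique-zs : Unique (z ∷ zs)
        unique-zs with _ ∷ u ← unique D = u
        unique-y : Unique (y ∷ z ∷ zs)
        unique-y = ∉⇒Unique-∷ y∉ unique-zs
        path′ : ∀ {u v} → Unique (v ∷ u ∷ z ∷ zs) → Linked (Mono col d) (u ∷ z ∷ zs) →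
                Linked (Mono col d) ((z ∷ zs) ∷ʳ v) → MonoPath′ col
        path′ {u} {v} uniq l l′ = d , u ∷ (z ∷ zs) ∷ʳ v ,
          trans (sym (↭-length (∷↭∷ʳ v (u ∷ z ∷ zs)))) (cong suc len) ,
          record { unique = Unique-resp-↭ (∷↭∷ʳ v (u ∷ z ∷ zs)) uniq
                 ; linked = Linked-join zs l l′ }
        cycle′ : ∀ {u} → Unique (u ∷ z ∷ zs) → Linked (Mono col d) (u ∷ z ∷ zs) →
                 Linked (Mono col d) ((z ∷ zs) ∷ʳ u) → MonoPath′ col
        cycle′ uniq l l′ = twoColours (d≢c ∘ sym) C
          (record { unique = uniq ; front = l ; back = l′ } , len)
        closing : EndsAt d (_∷ z ∷ zs) → EndsAt d ((z ∷ zs) ∷ʳ_) → MonoPath′ col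
        closing (inj₁ l) (inj₁ l′) = cycle′ (unique D) l l′
        closing (inj₂ l) (inj₂ l′) = cycle′ unique-y l l′
        closing (inj₁ l) (inj₂ l′) = path′ (∉⇒Unique-∷ (λ
          { (here y≡x₀) → x₀≢y (sym y≡x₀) ; (there y∈) → y∉ y∈ }) (unique D)) l l′
        closing (inj₂ l) (inj₁ l′) = path′ (∉⇒Unique-∷ (λ
          { (here x₀≡y) → x₀≢y x₀≡y ; (there x₀∈) → x₀∉ x₀∈ }) unique-y) l l′

      DisjointCycle : Set
      DisjointCycle = ∃₂ λ z zs → MonoCycle (2 * n) col c z zs ×
                      (∀ {v} → v ∈ z ∷ zs → v ∉ x₀ ∷ xs) × y ∉ z ∷ zs

      -- Away from `x₀` the recolouring changes nothing, so the cycle is one of `col`. If it has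
      -- colour `c` and lies inside the given cycle, equal length makes it cover that cycle,
      -- including `x₀`.
      avoidingContracted : ∀ {d z zs} → MonoCycle (2 * n) col* d z zs → y ∉ z ∷ zs →
                           x₀ ∉ z ∷ zs → MonoPath′ col ⊎ DisjointCycle
      avoidingContracted {d} {z} {zs} (D , len) y∉ x₀∉ = compare (d ≟ c)
        where
        D′ : IsCycle (Mono col d) z zs
        D′ = record
          { unique = unique D
          ; front  = Linked-col* x₀∉ (front D)
          ; back   = Linked-col* (x₀∉ ∘ ∈-resp-↭ (↭-sym (∷↭∷ʳ z zs))) (back D)
          }
        compare : Dec (d ≡ c) → MonoPath′ col ⊎ DisjointCycle
        compare (no d≢c) = inj₁ (twoColours (d≢c ∘ sym) C (D′ , len))
        compare (yes refl)
          with Separated⇒dichotomy Mono-sym (_∈ᶠ? (x₀ ∷ xs)) sepC (front D′)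
        ... | inj₁ inside  = contradiction (Unique-⊆⇒∈ (unique D) inside
                               (≤-reflexive (trans (proj₂ C) (sym len))) (here refl)) x₀∉
        ... | inj₂ outside = inj₂ (z , zs , (D′ , len) , outside , y∉)

      disjointCycle : MonoPath′ col ⊎ DisjointCycle
      -- `col*` still colours edges at `y`; deleting `y` here completes the contraction to `4n`
      -- vertices.
      disjointCycle with avoiding ramsey col* (λ _ _ → col-sym _ _) y
      ... | d , z , zs , (D , len) , y∉ with x₀ ∈ᶠ? (z ∷ zs)
      ...   | no x₀∉ = avoidingContracted (D , len) y∉ x₀∉
      ...   | yes x₀∈ with zs′ , D′ , p ← rotateTo x₀∈ D =
        inj₁ (throughContracted (D′ , trans (↭-length (↭-sym p)) len)
          (y∉ ∘ ∈-resp-↭ (↭-sym p) ∘ there))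

    open Contraction using (disjointCycle)

    monoPath : MonoPath′ col
    -- `0F` is an arbitrary vertex: deleting it ensures that some vertex off the first cycle is
    -- known, ready to be contracted.
    monoPath with c , x , xs , C , 0∉ ← avoiding ramsey col col-sym 0F with separated C
    ... | inj₁ p = p
    ... | inj₂ sepC with disjointCycle C sepC 0∉
    ...   | inj₁ p = p
    -- The second contraction uses `y`, a vertex of `D`, so that the new cycle `E` cannot have the
    -- same vertex set as `D`.
    ...   | inj₂ (y , ys , D , D∥C , _) with separated D | disjointCycle C sepC (D∥C (here refl))
    ...     | inj₁ p    | _      = p
    ...     | inj₂ _    | inj₁ p = p
    ...     | inj₂ sepD | inj₂ (z , zs , E , E∥C , y∉E)
        with Separated⇒dichotomy Mono-sym (_∈ᶠ? (y ∷ ys)) sepD (front (proj₁ E))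
    ...       | inj₁ inside  = contradiction
        (Unique-⊆⇒∈ (unique (proj₁ E)) inside
          (≤-reflexive (trans (proj₂ D) (sym (proj₂ E)))) (here refl))
        y∉E
    ...       | inj₂ outside = contradiction
        (≤-trans (≤-reflexive (sym total))
          (≤-trans (Unique-⊆⇒length≤ unique-all (λ _ → ∈-allFin _)) (≤-reflexive (length-tabulate id))))
        (too-large 0<n)
      where
      all-vertices = (x ∷ xs) ++ (y ∷ ys) ++ (z ∷ zs)
      unique-all : Unique all-vertices
      unique-all = ++⁺ (unique (proj₁ C))
        (++⁺ (unique (proj₁ D)) (unique (proj₁ E)) (λ (v∈D , v∈E) → outside v∈E v∈D))
        λ (v∈C , v∈) → [ (λ v∈D → D∥C v∈D v∈C) , (λ v∈E → E∥C v∈E v∈C) ]′ (∈-++⁻ (y ∷ ys) v∈)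
      total : length all-vertices ≡ 2 * n + (2 * n + 2 * n)
      total = trans (length-++ (x ∷ xs)) (cong₂ _+_ (proj₂ C)
        (trans (length-++ (y ∷ ys)) (cong₂ _+_ (proj₂ D) (proj₂ E))))
      -- Three disjoint cycles need `6n` vertices, which exceeds `4n + 1` once `n` is positive.
      too-large : ∀ {n} → 0 < n → ¬ (2 * n + (2 * n + 2 * n) ≤ suc (4 * n))
      too-large {suc n} _ p = ℕ.<⇒≱ (ℕ.m≤m+n _ (n + n)) (≤-trans (≤-reflexive (arith n)) p)
        where
        arith : ∀ n → suc (suc (4 * suc n)) + (n + n) ≡ 2 * suc n + (2 * suc n + 2 * suc n)
        arith = solve-∀

-- The lower bound

-- The three perfect matchings of K₄, one for each colour; loops get colour 0.
pairColour : Fin 4 → Fin 4 → Fin 3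
pairColour a b = Vec.lookup (Vec.lookup
  ( (0F ∷ 0F ∷ 1F ∷ 2F ∷ [])
  ∷ (0F ∷ 0F ∷ 2F ∷ 1F ∷ [])
  ∷ (1F ∷ 2F ∷ 0F ∷ 0F ∷ [])
  ∷ (2F ∷ 1F ∷ 0F ∷ 0F ∷ []) ∷ []) a) b
  where open Vec using ([]; _∷_)

-- side i a is the edge of the i-th matching that contains a, and end i a tells
-- which of its two endpoints a is.
side end : Fin 3 → Fin 4 → Fin 2
side i a = Vec.lookup (Vec.lookup
  ( (0F ∷ 0F ∷ 1F ∷ 1F ∷ [])
  ∷ (0F ∷ 1F ∷ 0F ∷ 1F ∷ [])
  ∷ (0F ∷ 1F ∷ 1F ∷ 0F ∷ []) ∷ []) i) a
  where open Vec using ([]; _∷_)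
end i a = Vec.lookup (Vec.lookup
  ( (0F ∷ 1F ∷ 0F ∷ 1F ∷ [])
  ∷ (0F ∷ 0F ∷ 1F ∷ 1F ∷ [])
  ∷ (0F ∷ 0F ∷ 1F ∷ 1F ∷ []) ∷ []) i) a
  where open Vec using ([]; _∷_)

pairColour-sym : ∀ a b → pairColour a b ≡ pairColour b a
pairColour-sym = toWitness {a? = all? λ a → all? λ b → pairColour a b ≟ pairColour b a} _

-- This covers `a ≡ b` too: edges inside a block have colour 0 and do not change the side.
pairColour⇒side : ∀ i a b → pairColour a b ≡ i → side i a ≡ side i b
pairColour⇒side = toWitness {a? = all? λ i → all? λ a → all? λ b →
  pairColour a b ≟ i →-dec side i a ≟ side i b} _

side-end-injective : ∀ i a b → side i a ≡ side i b → end i a ≡ end i b → a ≡ b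
side-end-injective = toWitness {a? = all? λ i → all? λ a → all? λ b →
  side i a ≟ side i b →-dec (end i a ≟ end i b →-dec a ≟ b)} _

-- If `M ≤ 4n`, the vertices fit into the four blocks. Along a path of colour `i` the side never
-- changes, so its `2n + 1` vertices would lie in two blocks of size `n`.
Forces₃-path⇒4n<M : ∀ n {M} → Forces₃ M (path (suc (2 * n))) → 4 * n < M
Forces₃-path⇒4n<M n {M} forces = ℕ.≰⇒> too-small
  where
  too-small : ¬ M ≤ 4 * n
  too-small M≤4n = ℕ.1+n≰n (injective⇒≤ place-injective)
    where
    block : Fin M → Fin 4 × Fin n
    block v = remQuot n (inject≤ v M≤4n)
    class : Fin M → Fin 4
    class = proj₁ ∘ block
    block-injective : ∀ {u v} → block u ≡ block v → u ≡ v
    block-injective eq = inject≤-injective M≤4n M≤4n _ _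
      (trans (sym (combine-remQuot {4} n _))
        (trans (cong (uncurry combine) eq) (combine-remQuot {4} n _)))
    χ : EdgeColouring (complete M) 3
    χ = record
      { colour     = λ u v _ → pairColour (class u) (class v)
      ; colour-sym = λ {u} {v} _ → pairColour-sym (class u) (class v)
      }
    i = proj₁ (forces χ)
    f : Embedding (path (suc (2 * n))) (colourClass χ i)
    f = Contains⇒Embedding (proj₂ (forces χ))
    step : ∀ j → side i (class (to f (inject₁ j))) ≡ side i (class (to f (suc j)))
    step j = pairColour⇒side i (class (to f (inject₁ j))) (class (to f (suc j)))
      (proj₂ (map-adj f (inj₁ (cong suc (sym (toℕ-inject₁ j))))))
    same-side : ∀ j → side i (class (to f j)) ≡ side i (class (to f zero))
    same-side = <-weakInduction _ refl λ j ih → trans (sym (step j)) ih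
    -- On the common side, `end` tells the two blocks apart and the remainder gives the position
    -- within the block.
    place : Fin (suc (2 * n)) → Fin (2 * n)
    place j = combine (end i (class (to f j))) (proj₂ (block (to f j)))
    place-injective : Injective _≡_ _≡_ place
    place-injective {j} {k} eq with p , q ← combine-injective _ _ _ _ eq =
      injective f (block-injective (cong₂ _,_
        (side-end-injective i (class (to f j)) (class (to f k))
          (trans (same-side j) (sym (same-side k))) p) q))

theorem6 : ∀ (n : ℕ) → 3 ≤ n →
    R₃[ cycle (2 * n) ]≡ (4 * n) →
    R₃[ path (2 * n + 1) ]≡ (4 * n + 1)
theorem6 n 3≤n (forces , _) =
  subst₂ (λ k N → R₃[ path k ]≡ N) (+-comm 1 (2 * n)) (+-comm 1 (4 * n))
    ( PathRamsey⇒Forces₃ (UpperBound.monoPath n 0<n (Forces₃⇒CycleRamsey 2≤2n forces))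
    , λ M → Forces₃-path⇒4n<M n
    )
  where
  0<n : 0 < n
  0<n = ≤-trans (s≤s z≤n) 3≤n
  2≤2n : 2 ≤ 2 * n
  2≤2n = ℕ.*-monoʳ-≤ 2 0<n
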